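{- Let $n\geq 4$ and $\varphi,\psi\in S_n$. The following conditions are equivalent: (i) there is $\alpha\in S_n$ with $\varphi^\alpha=\psi$, i.e. $\alpha\varphi=\psi\alpha$ (so $\varphi$ and $\psi$ are conjugate in $S_n$); (ii) the configurations $\mathfrak{M}_{(n,\varphi)}$ and $\mathfrak{M}_{(n,\psi)}$ are isomorphic.
   Context: A configuration is a pair $\langle S,\mathcal L\rangle$ where $S$ is a set of points and $\mathcal L$ is a family of subsets of $S$, called blocks. Two configurations $\langle S_1,\mathcal L_1\rangle$ and $\langle S_2,\mathcal L_2\rangle$ are isomorphic if there is a bijection $f\colon S_1\to S_2$ such that, for $k\subseteq S_1$, $k\in\mathcal L_1$ iff $f(k)\in\mathcal L_2$. Let $n\ge 3$, $I=\{1,\dots,n\}$, $\varphi\in S_n$ a permutation of $I$, and let $A=\{a_1,\dots,a_n\}$, $B=\{b_1,\dots,b_n\}$ be disjoint $n$-element sets. For $i\in I$ put $A_i=(A\setminus\{a_i\})\cup\{b_i\}$ and $B_i=(B\setminus\{b_i\})\cup\{a_{\varphi(i)}\}$. The Möbius $n$-pair $\mathfrak{M}_{(n,\varphi)}$ is the configuration with point set $A\cup B$ and block set $\{A_i: i\in I\}\cup\{B_i: i\in I\}$. -}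

module Defs where

open import Data.Fin.Base using (Fin)
open import Data.Fin.Permutation using (Permutation′; _⟨$⟩ʳ_)
open import Data.Nat.Base using (ℕ)
open import Data.Product.Base using (Σ-syntax; ∃-syntax; _×_; _,_)
open import Data.Sum.Base using (_⊎_; inj₁; inj₂)
open import Function.Bundles using (_⤖_; _⇔_; module Bijection)
open import Level using (0ℓ; suc)
open import Relation.Binary.Definitions using (_Respects_)
open import Relation.Binary.PropositionalEquality using (_≡_)
open import Relation.Unary using (Pred; _∈_; _≐_; _∪_; _∖_; ｛_｝)
open import Relation.Unary.Properties using (≐-sym; ≐-trans)

-- Subsets of a type are predicates, and two subsets are equal when they have
-- the same elements (_≐_); a family of subsets must not distinguish equal
-- subsets, hence blocks-resp-≐.

record Configuration : Set (suc 0ℓ) where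
  field
    Point         : Set
    Blocks        : Pred (Pred Point 0ℓ) 0ℓ
    blocks-resp-≐ : Blocks Respects _≐_

image : {X Y : Set} → (X → Y) → Pred X 0ℓ → Pred Y 0ℓ
image f k y = ∃[ x ] (x ∈ k × f x ≡ y)

_≅_ : Configuration → Configuration → Set (suc 0ℓ)
C ≅ D = Σ[ f ∈ C.Point ⤖ D.Point ]
          (∀ (k : Pred C.Point 0ℓ) → k ∈ C.Blocks ⇔ image (Bijection.to f) k ∈ D.Blocks)
  where
  module C = Configuration C
  module D = Configuration D

-- The disjoint n-element sets A and B are the two summands of Fin n ⊎ Fin n,
-- and I = {1,…,n} is Fin n.

MöbiusPoint : ℕ → Set
MöbiusPoint n = Fin n ⊎ Fin n

module _ {n : ℕ} where

  a b : Fin n → MöbiusPoint n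
  a = inj₁
  b = inj₂

  A B : Pred (MöbiusPoint n) 0ℓ
  A x = ∃[ i ] x ≡ a i
  B x = ∃[ i ] x ≡ b i

  A[_] : Fin n → Pred (MöbiusPoint n) 0ℓ
  A[ i ] = (A ∖ ｛ a i ｝) ∪ ｛ b i ｝

  B[_,_] : Permutation′ n → Fin n → Pred (MöbiusPoint n) 0ℓ
  B[ φ , i ] = (B ∖ ｛ b i ｝) ∪ ｛ a (φ ⟨$⟩ʳ i) ｝

𝔐 : (n : ℕ) → Permutation′ n → Configuration
𝔐 n φ = record
  { Point         = MöbiusPoint n
  ; Blocks        = λ k → (∃[ i ] k ≐ A[ i ]) ⊎ (∃[ i ] k ≐ B[ φ , i ])
  ; blocks-resp-≐ = λ where
      k≐l (inj₁ (i , k≐A)) → inj₁ (i , ≐-trans (≐-sym k≐l) k≐A)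
      k≐l (inj₂ (i , k≐B)) → inj₂ (i , ≐-trans (≐-sym k≐l) k≐B)
  }

{-# OPTIONS --safe #-}
-- A conjugating permutation acts on both copies of I and is an isomorphism.
-- Conversely, an isomorphism f acts on the blocks. If it maps all A_i to
-- blocks A_{α(i)}, then f(a_i) = a_{α(i)} and f(b_i) = b_{α(i)}, and the images
-- of the B_i give αφ = ψα. If it maps all A_i to blocks of type B, compose with
-- the automorphism a_i ↦ b_i, b_i ↦ a_{ψ(i)} of 𝔐_ψ. If A_i goes to A_p and A_j
-- to B_q, the n − 2 points of A_i ∩ A_j go to A_p ∩ B_q ⊆ {b_p, a_{ψ(q)}}, so
-- that n = 4 and two of the A_i go to each type; then f is known explicitly, and
-- sending i to the index of the image of A_i still conjugates φ to ψ.
module Submission where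

open import Defs
open import Data.Empty using (⊥; ⊥-elim)
open import Data.Fin.Base using (Fin; zero; suc)
open import Data.Fin.Permutation
  using (Permutation′; _∘ₚ_; _≈_; _⟨$⟩ʳ_; _⟨$⟩ˡ_; inverseˡ; inverseʳ; permutation)
open import Data.Fin.Properties using (_≟_; any?; <⇒notInjective)
open import Data.List.Base using (List; []; _∷_; length; lookup)
open import Data.List.Membership.Propositional using (_∉_)
open import Data.List.Membership.DecPropositional using (_∈?_)
open import Data.List.Relation.Unary.Any using (here; there; index)
open import Data.List.Relation.Unary.Any.Properties using (lookup-index)
open import Data.Nat.Base using (ℕ; _≥_; _<_; s≤s; z≤n)
open import Data.Nat.Properties using (≤-trans; n<1+n)
open import Data.Product.Base using (∃-syntax; _×_; _,_; proj₁; proj₂)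
open import Data.Sum.Base using (_⊎_; inj₁; inj₂; reduce)
open import Data.Sum.Function.Propositional using (_⊎-⤖_)
open import Data.Sum.Properties using (inj₁-injective; inj₂-injective)
open import Function.Base using (_∘_)
open import Function.Bundles using (_⤖_; _⇔_; mk⇔; module Equivalence; module Bijection)
open import Function.Construct.Composition using (_⇔-∘_)
open import Function.Construct.Symmetry using (⇔-sym)
open import Function.Definitions using (Injective)
open import Function.Properties.Inverse using (↔⇒⤖)
open import Level using (0ℓ)
open import Relation.Binary.PropositionalEquality
  using (_≡_; _≢_; refl; sym; trans; cong; subst)
open import Relation.Nullary using (¬_; Dec; yes; no; ¬?; contradiction)
open import Relation.Nullary.Decidable using (decidable-stable)
open import Relation.Unary using (Pred; _∈_; _≐_)
open import Relation.Unary.Properties using (≐-sym; ≐-trans)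

open Equivalence using (to; from)

private
  variable
    n : ℕ

-- Pigeonhole arguments on `Fin n`.

≢-stable : {i j : Fin n} → ¬ (i ≢ j) → i ≡ j
≢-stable {i = i} {j} = decidable-stable (i ≟ j)

-- Otherwise sending each element to its position in `xs` would inject `Fin n` into a smaller `Fin`.
fresh : (xs : List (Fin n)) → length xs < n → ∃[ x ] x ∉ xs
fresh {n} xs |xs|<n with any? (λ x → ¬? (_∈?_ _≟_ x xs))
... | yes found = found
... | no  none  = ⊥-elim (<⇒notInjective {f = index ∘ covered} |xs|<n index-injective)
  where
  covered : ∀ x → _
  covered x = decidable-stable (_∈?_ _≟_ x xs) (λ x∉xs → none (x , x∉xs))

  index-injective : Injective _≡_ _≡_ (index ∘ covered)
  index-injective {x} {y} eq =
    trans (lookup-index (covered x))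
      (trans (cong (lookup xs) eq) (sym (lookup-index (covered y))))

-- A missed `y`, adjoined as one more value, would extend `α` to an injection of n + 1 elements into
-- n.
injective⇒hit : {α : Fin n → Fin n} → Injective _≡_ _≡_ α → ∀ y → ∃[ x ] α x ≡ y
injective⇒hit {n} {α} α-inj y with any? (λ x → α x ≟ y)
... | yes hit  = hit
... | no  miss = ⊥-elim (<⇒notInjective {f = extended} (n<1+n n) extended-injective)
  where
  extended : Fin (ℕ.suc n) → Fin n
  extended zero    = y
  extended (suc x) = α x

  extended-injective : Injective _≡_ _≡_ extended
  extended-injective {zero}  {zero}  _  = refl
  extended-injective {zero}  {suc x} eq = contradiction (x , sym eq) miss
  extended-injective {suc x} {zero}  eq = contradiction (x , eq) miss
  extended-injective {suc x} {suc z} eq = cong suc (α-inj eq)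

-- Conjugacy in the symmetric group.

Conjugate : Permutation′ n → Permutation′ n → Set
Conjugate φ ψ = ∃[ α ] φ ∘ₚ α ≈ α ∘ₚ ψ

⟨$⟩ʳ-injective : (π : Permutation′ n) → Injective _≡_ _≡_ (π ⟨$⟩ʳ_)
⟨$⟩ʳ-injective π eq = trans (sym (inverseˡ π)) (trans (cong (π ⟨$⟩ˡ_) eq) (inverseˡ π))

-- By finiteness injectivity already makes `α` a permutation. Since `∘ₚ` applies its left factor
-- first, `Conjugate` says αφ = ψα.
injection⇒conjugate : (φ ψ : Permutation′ n) {α : Fin n → Fin n} → Injective _≡_ _≡_ α →
  (∀ i → α (φ ⟨$⟩ʳ i) ≡ ψ ⟨$⟩ʳ α i) → Conjugate φ ψ
injection⇒conjugate φ ψ {α} α-inj αφ≡ψα =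
  permutation α (proj₁ ∘ hit) (proj₂ ∘ hit) (λ x → α-inj (proj₂ (hit (α x)))) , αφ≡ψα
  where hit = injective⇒hit α-inj

-- Blocks as labels, membership as incidence.

Label : ℕ → Set
Label n = Fin n ⊎ Fin n

pattern 𝒜 i = inj₁ i
pattern ℬ i = inj₂ i

block : Permutation′ n → Label n → Pred (MöbiusPoint n) 0ℓ
block φ (𝒜 i) = A[ i ]
block φ (ℬ i) = B[ φ , i ]

-- Membership in a block, reduced to an equality or inequality of indices.
Incident : Permutation′ n → MöbiusPoint n → Label n → Set
Incident φ (inj₁ j) (𝒜 i) = i ≢ j
Incident φ (inj₂ j) (𝒜 i) = i ≡ j
Incident φ (inj₁ j) (ℬ i) = φ ⟨$⟩ʳ i ≡ j
Incident φ (inj₂ j) (ℬ i) = i ≢ j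

incident⇔∈ : (φ : Permutation′ n) → ∀ x l → Incident φ x l ⇔ x ∈ block φ l
incident⇔∈ φ (inj₁ j) (𝒜 i) = mk⇔
  (λ i≢j → inj₁ ((j , refl) , λ eq → i≢j (inj₁-injective eq)))
  (λ { (inj₁ (_ , ai≢aj)) refl → ai≢aj refl })
incident⇔∈ φ (inj₂ j) (𝒜 i) = mk⇔
  (λ { refl → inj₂ refl })
  (λ { (inj₁ ((_ , ()) , _)) ; (inj₂ eq) → inj₂-injective eq })
incident⇔∈ φ (inj₁ j) (ℬ i) = mk⇔
  (λ { refl → inj₂ refl })
  (λ { (inj₁ ((_ , ()) , _)) ; (inj₂ eq) → inj₁-injective eq })
incident⇔∈ φ (inj₂ j) (ℬ i) = mk⇔
  (λ i≢j → inj₁ ((j , refl) , λ eq → i≢j (inj₂-injective eq)))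
  (λ { (inj₁ (_ , bi≢bj)) refl → bi≢bj refl })

Blocks⇔∃label : (φ : Permutation′ n) (k : Pred (MöbiusPoint n) 0ℓ) →
  k ∈ Configuration.Blocks (𝔐 n φ) ⇔ (∃[ l ] k ≐ block φ l)
Blocks⇔∃label φ k = mk⇔
  (λ { (inj₁ (i , eq)) → 𝒜 i , eq ; (inj₂ (i , eq)) → ℬ i , eq })
  (λ { (𝒜 i , eq) → inj₁ (i , eq) ; (ℬ i , eq) → inj₂ (i , eq) })

-- Conjugate permutations give isomorphic configurations

-- Moving the bijection to the other side lets blocks be compared point by point.
image-≐ : {X Y : Set} (f : X ⤖ Y) {k : Pred X 0ℓ} {l : Pred Y 0ℓ} →
  (image (Bijection.to f) k ≐ l) ⇔ (k ≐ l ∘ Bijection.to f)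
image-≐ f {k} {l} = mk⇔
  (λ (fk⊆l , l⊆fk) →
    (λ x∈k → fk⊆l (_ , x∈k , refl)) ,
    (λ fx∈l → let (_ , z∈k , eq) = l⊆fk fx∈l in subst k (Bijection.injective f eq) z∈k))
  (λ (k⊆fl , fl⊆k) →
    (λ { (_ , x∈k , refl) → k⊆fl x∈k }) ,
    (λ {y} y∈l → let (x , eq) = Bijection.strictlySurjective f y in
                 x , fl⊆k (subst l (sym eq) y∈l) , eq))

relabel : Permutation′ n → Label n → Label n
relabel α (𝒜 i) = 𝒜 (α ⟨$⟩ʳ i)
relabel α (ℬ i) = ℬ (α ⟨$⟩ʳ i)

relabel-hit : (α : Permutation′ n) → ∀ l → ∃[ k ] relabel α k ≡ l
relabel-hit α (𝒜 i) = 𝒜 (α ⟨$⟩ˡ i) , cong 𝒜 (inverseʳ α)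
relabel-hit α (ℬ i) = ℬ (α ⟨$⟩ˡ i) , cong ℬ (inverseʳ α)

conjugate⇒iso : (φ ψ : Permutation′ n) → Conjugate φ ψ → 𝔐 n φ ≅ 𝔐 n ψ
conjugate⇒iso {n} φ ψ (α , αφ≡ψα) = f , λ k →
  ⇔-sym (Blocks⇔∃label ψ _) ⇔-∘ (labels k ⇔-∘ Blocks⇔∃label φ k)
  where
  f : MöbiusPoint n ⤖ MöbiusPoint n
  f = ↔⇒⤖ α ⊎-⤖ ↔⇒⤖ α

  α-inj = ⟨$⟩ʳ-injective α

  incident : ∀ x l → Incident φ x l ⇔ Incident ψ (Bijection.to f x) (relabel α l)
  incident (inj₁ j) (𝒜 i) = mk⇔ (_∘ α-inj) (_∘ cong (α ⟨$⟩ʳ_))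
  incident (inj₂ j) (𝒜 i) = mk⇔ (cong (α ⟨$⟩ʳ_)) α-inj
  incident (inj₁ j) (ℬ i) = mk⇔
    (λ eq → trans (sym (αφ≡ψα i)) (cong (α ⟨$⟩ʳ_) eq))
    (λ eq → α-inj (trans (αφ≡ψα i) eq))
  incident (inj₂ j) (ℬ i) = mk⇔ (_∘ α-inj) (_∘ cong (α ⟨$⟩ʳ_))

  preimage-block : ∀ l → block φ l ≐ block ψ (relabel α l) ∘ Bijection.to f
  preimage-block l =
    (λ {x} → to (incident⇔∈ ψ (Bijection.to f x) (relabel α l)) ∘ to (incident x l)
           ∘ from (incident⇔∈ φ x l)) ,
    (λ {x} → to (incident⇔∈ φ x l) ∘ from (incident x l)
           ∘ from (incident⇔∈ ψ (Bijection.to f x) (relabel α l)))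

  labels : ∀ k →
    (∃[ l ] k ≐ block φ l) ⇔ (∃[ l ] image (Bijection.to f) k ≐ block ψ l)
  labels k = mk⇔
    (λ (l , eq) → relabel α l , from (image-≐ f) (≐-trans eq (preimage-block l)))
    backward
    where
    backward : (∃[ l ] image (Bijection.to f) k ≐ block ψ l) → ∃[ l ] k ≐ block φ l
    -- Relabelling is onto, so the block `l` is itself the image of a block of the source.
    backward (l , eq) with relabel-hit α l
    ... | l′ , refl = l′ , ≐-trans (to (image-≐ f) eq) (≐-sym (preimage-block l′))

-- Isomorphic configurations come from conjugate permutations

record Embedding (φ ψ : Permutation′ n) : Set where
  field
    point     : MöbiusPoint n → MöbiusPoint n
    label     : Label n → Label n
    injective : Injective _≡_ _≡_ point
    incidence : ∀ x l → Incident φ x l ⇔ Incident ψ (point x) (label l)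

iso⇒embedding : (φ ψ : Permutation′ n) → 𝔐 n φ ≅ 𝔐 n ψ → Embedding φ ψ
iso⇒embedding {n} φ ψ (f , blocks) = record
  { point     = Bijection.to f
  ; label     = proj₁ ∘ image-label
  ; injective = Bijection.injective f
  ; incidence = λ x l → mk⇔
      (λ x∈l → from (incident⇔∈ ψ _ (proj₁ (image-label l)))
        (proj₁ (preimage l) (to (incident⇔∈ φ x l) x∈l)))
      (λ fx∈gl → from (incident⇔∈ φ x l)
        (proj₂ (preimage l) (to (incident⇔∈ ψ _ (proj₁ (image-label l))) fx∈gl)))
  }
  where
  image-label : ∀ l → ∃[ l′ ] image (Bijection.to f) (block φ l) ≐ block ψ l′
  image-label l = to (Blocks⇔∃label ψ _)
    (to (blocks (block φ l)) (from (Blocks⇔∃label φ _) (l , (λ z → z) , (λ z → z))))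

  preimage : ∀ l → block φ l ≐ block ψ (proj₁ (image-label l)) ∘ Bijection.to f
  preimage l = to (image-≐ f) (proj₂ (image-label l))

-- The automorphism a_i ↦ b_i, b_i ↦ a_{ψ(i)} sends A_i to B_i and B_i to A_{ψ(i)}. It exchanges the
-- two types of blocks, so a result about one type transfers to the other.
dual : {φ ψ : Permutation′ n} → Embedding φ ψ → Embedding φ ψ
dual {n} {φ} {ψ} e = record
  { point     = swap-point ∘ point
  ; label     = swap-label ∘ label
  ; injective = injective ∘ swap-point-injective
  ; incidence = λ x l → swap-incidence (point x) (label l) ⇔-∘ incidence x l
  }
  where
  open Embedding e

  ψ-inj = ⟨$⟩ʳ-injective ψ

  swap-point : MöbiusPoint n → MöbiusPoint n
  swap-point (inj₁ i) = b i
  swap-point (inj₂ i) = a (ψ ⟨$⟩ʳ i)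

  swap-label : Label n → Label n
  swap-label (𝒜 i) = ℬ i
  swap-label (ℬ i) = 𝒜 (ψ ⟨$⟩ʳ i)

  swap-point-injective : Injective _≡_ _≡_ swap-point
  swap-point-injective {inj₁ _} {inj₁ _} eq = cong a (inj₂-injective eq)
  swap-point-injective {inj₂ _} {inj₂ _} eq = cong b (ψ-inj (inj₁-injective eq))

  swap-incidence : ∀ x l → Incident ψ x l ⇔ Incident ψ (swap-point x) (swap-label l)
  swap-incidence (inj₁ j) (𝒜 i) = mk⇔ (λ p → p) (λ p → p)
  swap-incidence (inj₂ j) (𝒜 i) = mk⇔ (cong (ψ ⟨$⟩ʳ_)) ψ-inj
  swap-incidence (inj₁ j) (ℬ i) = mk⇔ (λ p → p) (λ p → p)
  swap-incidence (inj₂ j) (ℬ i) = mk⇔ (_∘ ψ-inj) (_∘ cong (ψ ⟨$⟩ʳ_))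

module _ {n : ℕ} (n≥4 : n ≥ 4) {φ ψ : Permutation′ n} where

  third : (i j : Fin n) → ∃[ k ] (k ≢ i × k ≢ j)
  third i j with fresh (i ∷ j ∷ []) (≤-trans (s≤s (s≤s (s≤s z≤n))) n≥4)
  ... | k , k∉ = k , k∉ ∘ here , k∉ ∘ there ∘ here

  fourth : (i j k : Fin n) → ∃[ l ] (l ≢ i × l ≢ j × l ≢ k)
  fourth i j k with fresh (i ∷ j ∷ k ∷ []) n≥4
  ... | l , l∉ = l , l∉ ∘ here , l∉ ∘ there ∘ here , l∉ ∘ there ∘ there ∘ here

  -- Action of an embedding on the blocks A_i.

  module EmbeddingProperties (e : Embedding φ ψ) where
    open Embedding e

    -- The index of the image block, whatever its type; this is the conjugating map to be found.
    α : Fin n → Fin n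
    α i = reduce (label (𝒜 i))

    To𝒜 Toℬ : Fin n → Set
    To𝒜 i = label (𝒜 i) ≡ 𝒜 (α i)
    Toℬ i = label (𝒜 i) ≡ ℬ (α i)

    kind : ∀ i → To𝒜 i ⊎ Toℬ i
    kind i with label (𝒜 i)
    ... | 𝒜 _ = inj₁ refl
    ... | ℬ _ = inj₂ refl

    kinds-disjoint : ∀ {i} → To𝒜 i → ¬ Toℬ i
    kinds-disjoint S T with trans (sym S) T
    ... | ()

    on : ∀ {x y l m} → point x ≡ y → label l ≡ m → Incident φ x l → Incident ψ y m
    on {x} {l = l} refl refl = to (incidence x l)

    -- When incidence in the target is an inequality, the result is a double negation, which
    -- `≢-stable` turns into an equation of indices.
    off : ∀ {x y l m} → point x ≡ y → label l ≡ m → ¬ Incident φ x l → ¬ Incident ψ y m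
    off {x} {l = l} refl refl = _∘ from (incidence x l)

    -- For i ≠ j the point a_j lies in A_i but not in A_j.
    label-𝒜-injective : ∀ {i j} → label (𝒜 i) ≡ label (𝒜 j) → i ≡ j
    label-𝒜-injective {i} {j} eq = ≢-stable λ i≢j →
      off {a j} refl refl (λ j≢j → j≢j refl) (on {a j} refl eq i≢j)

    To𝒜-injective : ∀ {i j} → To𝒜 i → To𝒜 j → α i ≡ α j → i ≡ j
    To𝒜-injective Si Sj eq = label-𝒜-injective (trans Si (trans (cong 𝒜 eq) (sym Sj)))

    Toℬ-injective : ∀ {i j} → Toℬ i → Toℬ j → α i ≡ α j → i ≡ j
    Toℬ-injective Ti Tj eq = label-𝒜-injective (trans Ti (trans (cong ℬ eq) (sym Tj)))

    collision : ∀ {i j y} → i ≢ j → point (a i) ≡ y → point (a j) ≡ y → ⊥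
    collision i≢j fi fj = i≢j (inj₁-injective (injective (trans fi (sym fj))))

    point-a≢point-b : ∀ {i j y} → point (a i) ≡ y → point (b j) ≡ y → ⊥
    point-a≢point-b fi fj with injective (trans fi (sym fj))
    ... | ()

    -- All A_i go to blocks of type A.

    module Straight (S : ∀ i → To𝒜 i) where

      α-injective : Injective _≡_ _≡_ α
      α-injective {i} {j} = To𝒜-injective (S i) (S j)

      not-constant-off : ∀ i m → ¬ (∀ j → j ≢ i → α j ≡ m)
      not-constant-off i m constant =
        let (j , j≢i , _)   = third i i
            (k , k≢i , k≢j) = third i j
        in k≢j (α-injective (trans (constant k k≢i) (sym (constant j j≢i))))

      -- The point a_i misses A_i and lies in every other A_j, whereas b_m lies in A_m alone among
      -- the blocks of type A.
      point-a : ∀ i → point (a i) ≡ a (α i)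
      point-a i with point (a i) in eq
      ... | inj₁ m = cong a (sym (≢-stable (off eq (S i) (λ i≢i → i≢i refl))))
      ... | inj₂ m = ⊥-elim (not-constant-off i m λ j j≢i → on eq (S j) j≢i)

      -- The point b_i lies in A_i and misses every other A_j, whereas a_m misses A_m alone among
      -- the blocks of type A.
      point-b : ∀ i → point (b i) ≡ b (α i)
      point-b i with point (b i) in eq
      ... | inj₂ m = cong b (sym (on eq (S i) refl))
      ... | inj₁ m = ⊥-elim (not-constant-off i m λ j j≢i → ≢-stable (off eq (S j) j≢i))

      α-conjugates : ∀ i → α (φ ⟨$⟩ʳ i) ≡ ψ ⟨$⟩ʳ α i
      α-conjugates i with label (ℬ i) in eq
      -- That b_i is not in B_i gives m = α(i); that a_{φ(i)} is in B_i gives ψ(m) = α(φ(i)).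
      ... | ℬ m = sym (trans (cong (ψ ⟨$⟩ʳ_) (sym m≡αi)) (on (point-a _) eq refl))
        where m≡αi = ≢-stable (off (point-b i) eq (λ i≢i → i≢i refl))
      -- A block of type A contains a single b, but the image of B_i contains b_{α(j)} for every j ≠
      -- i.
      ... | 𝒜 m = ⊥-elim (not-constant-off i m λ j j≢i →
                sym (on (point-b j) eq (j≢i ∘ sym)))

      conjugate : Conjugate φ ψ
      conjugate = injection⇒conjugate φ ψ α-injective α-conjugates

    -- Blocks A_i going to both types.

    crossing : ∀ {i j m} → To𝒜 i → Toℬ j → m ≢ i → m ≢ j →
      (point (a m) ≡ b (α i) × α j ≢ α i) ⊎
      (point (a m) ≡ a (ψ ⟨$⟩ʳ α j) × α i ≢ ψ ⟨$⟩ʳ α j)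
    -- As a_m is in both A_i and A_j, its image is in the intersection of A_{α(i)} and B_{α(j)},
    -- whose only candidates are b_{α(i)} and a_{ψ(α(j))}.
    crossing {m = m} Si Tj m≢i m≢j with point (a m) in eq
    ... | inj₁ y with on eq Tj (m≢j ∘ sym)
    ...   | refl = inj₂ (refl , on eq Si (m≢i ∘ sym))
    crossing {m = m} Si Tj m≢i m≢j | inj₂ y with on eq Si (m≢i ∘ sym)
    ...   | refl = inj₁ (refl , on eq Tj (m≢j ∘ sym))

    -- Two further indices, available as n ≥ 4, give two distinct points in that intersection, so
    -- both candidates lie in it.
    separated : ∀ {i j} → To𝒜 i → Toℬ j → α j ≢ α i × α i ≢ ψ ⟨$⟩ʳ α j
    separated {i} {j} Si Tj with third i j
    ... | k , k≢i , k≢j with fourth i j k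
    ...   | l , l≢i , l≢j , l≢k with crossing Si Tj k≢i k≢j | crossing Si Tj l≢i l≢j
    ...     | inj₁ (fk , _) | inj₁ (fl , _) = ⊥-elim (collision l≢k fl fk)
    ...     | inj₁ (_ , p)  | inj₂ (_ , q)  = p , q
    ...     | inj₂ (_ , q)  | inj₁ (_ , p)  = p , q
    ...     | inj₂ (fk , _) | inj₂ (fl , _) = ⊥-elim (collision l≢k fl fk)

    -- The other candidate is in A_{α(k)} by `separated`, while a_k is not in A_k.
    point-a-𝒜 : ∀ {i j k} → To𝒜 i → To𝒜 k → Toℬ j → k ≢ i → point (a k) ≡ b (α i)
    point-a-𝒜 Si Sk Tj k≢i
      with crossing Si Tj k≢i (λ { refl → kinds-disjoint Sk Tj })
    ... | inj₁ (fk , _) = fk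
    ... | inj₂ (fk , _) = contradiction (proj₂ (separated Sk Tj))
                            (off fk Sk (λ k≢k → k≢k refl))

    point-a-ℬ : ∀ {i j l} → To𝒜 i → Toℬ j → Toℬ l → l ≢ j → point (a l) ≡ a (ψ ⟨$⟩ʳ α j)
    point-a-ℬ Si Tj Tl l≢j
      with crossing Si Tj (λ { refl → kinds-disjoint Si Tl }) l≢j
    ... | inj₁ (fl , _) = contradiction (proj₁ (separated Si Tl))
                            (off fl Tl (λ l≢l → l≢l refl))
    ... | inj₂ (fl , _) = fl

    -- The four indices are distinct and exhaust I, so n = 4.
    record Split (i k j l : Fin n) : Set where
      field
        Si : To𝒜 i
        Sk : To𝒜 k
        Tj : Toℬ j
        Tl : Toℬ l
        k≢i : k ≢ i
        l≢j : l ≢ j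
        exhaustive : ∀ m → m ≡ i ⊎ m ≡ k ⊎ m ≡ j ⊎ m ≡ l

    flip : ∀ {i k j l} → Split i k j l → Split k i j l
    flip s = record
      { Si = Sk ; Sk = Si ; Tj = Tj ; Tl = Tl ; k≢i = k≢i ∘ sym ; l≢j = l≢j
      ; exhaustive = λ m → exchange (exhaustive m)
      }
      where
      open Split s

      exchange : ∀ {P Q R : Set} → P ⊎ Q ⊎ R → Q ⊎ P ⊎ R
      exchange (inj₁ p)        = inj₂ (inj₁ p)
      exchange (inj₂ (inj₁ q)) = inj₁ q
      exchange (inj₂ (inj₂ r)) = inj₂ (inj₂ r)

    -- Both a_k and a_m would go to b_{α(i)}.
    no-three-𝒜 : ∀ {i k m j} → To𝒜 i → To𝒜 k → To𝒜 m → Toℬ j → k ≢ i → m ≢ i → ¬ (m ≢ k)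
    no-three-𝒜 Si Sk Sm Tj k≢i m≢i m≢k =
      collision m≢k (point-a-𝒜 Si Sm Tj m≢i) (point-a-𝒜 Si Sk Tj k≢i)

    no-three-ℬ : ∀ {i j l m} → To𝒜 i → Toℬ j → Toℬ l → Toℬ m → l ≢ j → m ≢ j → ¬ (m ≢ l)
    no-three-ℬ Si Tj Tl Tm l≢j m≢j m≢l =
      collision m≢l (point-a-ℬ Si Tj Tm m≢j) (point-a-ℬ Si Tj Tl l≢j)

    split-of : ∀ {i k j l} → To𝒜 i → To𝒜 k → Toℬ j → Toℬ l → k ≢ i → l ≢ j → Split i k j l
    split-of {i} {k} {j} {l} Si Sk Tj Tl k≢i l≢j = record
      { Si = Si ; Sk = Sk ; Tj = Tj ; Tl = Tl ; k≢i = k≢i ; l≢j = l≢j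
      ; exhaustive = exhaustive
      }
      where
      exhaustive : ∀ m → m ≡ i ⊎ m ≡ k ⊎ m ≡ j ⊎ m ≡ l
      exhaustive m with m ≟ i | m ≟ j | kind m
      ... | yes m≡i | _       | _       = inj₁ m≡i
      ... | no  _   | yes m≡j | _       = inj₂ (inj₂ (inj₁ m≡j))
      ... | no  m≢i | no  _   | inj₁ Sm =
        inj₂ (inj₁ (≢-stable (no-three-𝒜 Si Sk Sm Tj k≢i m≢i)))
      ... | no  _   | no  m≢j | inj₂ Tm =
        inj₂ (inj₂ (inj₂ (≢-stable (no-three-ℬ Si Tj Tl Tm l≢j m≢j))))

    split : ∀ {i j} → To𝒜 i → Toℬ j → ∃[ k ] ∃[ l ] Split i k j l
    split {i} {j} Si Tj with third i j
    ... | k , k≢i , k≢j with fourth i j k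
    -- If `k` and `l` had the same type, that type would occur three times.
    ...   | l , l≢i , l≢j , l≢k with kind k | kind l
    ...     | inj₁ Sk | inj₁ Sl = contradiction l≢k (no-three-𝒜 Si Sk Sl Tj k≢i l≢i)
    ...     | inj₁ Sk | inj₂ Tl = k , l , split-of Si Sk Tj Tl k≢i l≢j
    ...     | inj₂ Tk | inj₁ Sl = l , k , split-of Si Sl Tj Tk l≢i k≢j
    ...     | inj₂ Tk | inj₂ Tl = contradiction l≢k (no-three-ℬ Si Tj Tk Tl k≢j l≢j)

    -- Since b_i is in A_i, an image among the b's could only be b_{α(i)}, already the image of a_k.
    -- Since b_i is not in A_k, an image among the a's must be a_{α(k)}.
    point-b-𝒜 : ∀ {i k j} → To𝒜 i → To𝒜 k → Toℬ j → k ≢ i → point (b i) ≡ a (α k)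
    point-b-𝒜 {i} Si Sk Tj k≢i with point (b i) in eq
    ... | inj₁ y = cong a (sym (≢-stable (off eq Sk k≢i)))
    ... | inj₂ y = ⊥-elim (point-a≢point-b (point-a-𝒜 Si Sk Tj k≢i)
                     (trans eq (cong b (sym (on eq Si refl)))))

    point-b-ℬ : ∀ {i j l} → To𝒜 i → Toℬ j → Toℬ l → l ≢ j → point (b l) ≡ b (α j)
    point-b-ℬ {l = l} Si Tj Tl l≢j with point (b l) in eq
    ... | inj₁ y = ⊥-elim (point-a≢point-b (point-a-ℬ Si Tl Tj (l≢j ∘ sym))
                     (trans eq (cong a (sym (on eq Tl refl)))))
    ... | inj₂ y = cong b (sym (≢-stable (off eq Tj (l≢j ∘ sym))))

    -- Found by locating the image of B_i, all relevant points having known images.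
    successor : ∀ {i k j l} → Split i k j l →
      (φ ⟨$⟩ʳ i ≡ i × ψ ⟨$⟩ʳ α i ≡ α i) ⊎ (φ ⟨$⟩ʳ i ≡ k × ψ ⟨$⟩ʳ α k ≡ α i)
    successor {i} {k} {j} {l} s = by-label (label (ℬ i)) refl
      where
      open Split s

      ψ-inj = ⟨$⟩ʳ-injective ψ

      i≢j : i ≢ j
      i≢j refl = kinds-disjoint Si Tj

      i≢l : i ≢ l
      i≢l refl = kinds-disjoint Si Tl

      fai = point-a-𝒜 Sk Si Tj (k≢i ∘ sym)
      fak = point-a-𝒜 Si Sk Tj k≢i
      faj = point-a-ℬ Si Tl Tj (l≢j ∘ sym)
      fal = point-a-ℬ Si Tj Tl l≢j
      fbk = point-b-𝒜 Sk Si Tj (k≢i ∘ sym)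
      fbj = point-b-ℬ Si Tl Tj (l≢j ∘ sym)
      fbl = point-b-ℬ Si Tj Tl l≢j

      by-label : ∀ m → label (ℬ i) ≡ m →
        (φ ⟨$⟩ʳ i ≡ i × ψ ⟨$⟩ʳ α i ≡ α i) ⊎ (φ ⟨$⟩ʳ i ≡ k × ψ ⟨$⟩ʳ α k ≡ α i)
      -- Both b_j and b_l are in B_i and go to distinct b's, too many for a block of type A.
      by-label (𝒜 m) eq = contradiction
        (Toℬ-injective Tl Tj (trans (sym (on fbj eq i≢j)) (on fbl eq i≢l))) l≢j
      -- The point b_k of B_i goes to a_{α(i)}, so ψ(m) = α(i). When φ(i) is i or k, the other of
      -- a_i, a_k misses B_i and determines m.
      by-label (ℬ m) eq with exhaustive (φ ⟨$⟩ʳ i)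
      ... | inj₁ φi≡i = inj₁ (φi≡i , trans (cong (ψ ⟨$⟩ʳ_) (sym m≡αi)) ψm≡αi)
        where
        ψm≡αi = on fbk eq (k≢i ∘ sym)
        m≡αi = ≢-stable (off fak eq (λ φi≡k → k≢i (trans (sym φi≡k) φi≡i)))
      ... | inj₂ (inj₁ φi≡k) = inj₂ (φi≡k , trans (cong (ψ ⟨$⟩ʳ_) (sym m≡αk)) ψm≡αi)
        where
        ψm≡αi = on fbk eq (k≢i ∘ sym)
        m≡αk = ≢-stable (off fai eq (λ φi≡i → k≢i (trans (sym φi≡k) φi≡i)))
      -- Here a_j in B_i forces m = α(l), but b_j in B_i goes to b_{α(l)}, which is not in B_{α(l)}.
      ... | inj₂ (inj₂ (inj₁ φi≡j)) =
        contradiction (ψ-inj (on faj eq φi≡j)) (on fbj eq i≢j)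
      ... | inj₂ (inj₂ (inj₂ φi≡l)) =
        contradiction (ψ-inj (on fal eq φi≡l)) (on fbl eq i≢l)

    α-conjugates-𝒜 : ∀ {i k j l} → Split i k j l →
      (φ ⟨$⟩ʳ i ≡ i ⊎ φ ⟨$⟩ʳ i ≡ k) × α (φ ⟨$⟩ʳ i) ≡ ψ ⟨$⟩ʳ α i
    α-conjugates-𝒜 s with successor s | successor (flip s)
    ... | inj₁ (φi≡i , ψαi≡αi) | _ = inj₁ φi≡i , trans (cong α φi≡i) (sym ψαi≡αi)
    ... | inj₂ (φi≡k , _) | inj₁ (φk≡k , _) =
      contradiction (⟨$⟩ʳ-injective φ (trans φk≡k (sym φi≡k))) (Split.k≢i s)
    -- Here φ exchanges i and k; the value of ψ at α(i) comes from the flipped split.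
    ... | inj₂ (φi≡k , _) | inj₂ (_ , ψαi≡αk) =
      inj₂ φi≡k , trans (cong α φi≡k) (sym ψαi≡αk)

    α-injective : ∀ {i j} → To𝒜 i → Toℬ j → Injective _≡_ _≡_ α
    α-injective _ _ {x} {y} eq with kind x | kind y
    ... | inj₁ Sx | inj₁ Sy = To𝒜-injective Sx Sy eq
    ... | inj₁ Sx | inj₂ Ty = contradiction (sym eq) (proj₁ (separated Sx Ty))
    ... | inj₂ Tx | inj₁ Sy = contradiction eq (proj₁ (separated Sy Tx))
    ... | inj₂ Tx | inj₂ Ty = Toℬ-injective Tx Ty eq

  -- The two indices going to type B, by duality.

  module Mixed (e : Embedding φ ψ) where
    open EmbeddingProperties e
    module Dual = EmbeddingProperties (dual e)

    dual-𝒜 : ∀ {i} → To𝒜 i → Dual.Toℬ i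
    dual-𝒜 {i} S rewrite S = refl

    dual-ℬ : ∀ {j} → Toℬ j → Dual.To𝒜 j
    dual-ℬ {j} T rewrite T = refl

    dual-α : ∀ {j} → Toℬ j → Dual.α j ≡ ψ ⟨$⟩ʳ α j
    dual-α {j} T rewrite T = refl

    dual-split : ∀ {i k j l} → Split i k j l → Dual.Split j l i k
    dual-split s = Dual.split-of (dual-ℬ Tj) (dual-ℬ Tl) (dual-𝒜 Si) (dual-𝒜 Sk) l≢j k≢i
      where open Split s

    -- On these indices the dual map is ψα, so the dual equation is ψαφ(j) = ψψα(j), and ψ cancels.
    -- This uses that φ(j) is again j or l.
    α-conjugates-ℬ : ∀ {i k j l} → Toℬ j → Toℬ l → Dual.Split j l i k →
      α (φ ⟨$⟩ʳ j) ≡ ψ ⟨$⟩ʳ α j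
    α-conjugates-ℬ {j = j} {l} Tj Tl s with Dual.α-conjugates-𝒜 s
    ... | φj∈ , eq = ⟨$⟩ʳ-injective ψ
      (trans (sym (dual-α (Tφj φj∈))) (trans eq (cong (ψ ⟨$⟩ʳ_) (dual-α Tj))))
      where
      Tφj : φ ⟨$⟩ʳ j ≡ j ⊎ φ ⟨$⟩ʳ j ≡ l → Toℬ (φ ⟨$⟩ʳ j)
      Tφj (inj₁ φj≡j) = subst Toℬ (sym φj≡j) Tj
      Tφj (inj₂ φj≡l) = subst Toℬ (sym φj≡l) Tl

    mixed⇒conjugate : ∀ {i j} → To𝒜 i → Toℬ j → Conjugate φ ψ
    mixed⇒conjugate Si Tj with split Si Tj
    ... | k , l , s = injection⇒conjugate φ ψ (α-injective Si Tj) conjugates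
      where
      conjugates : ∀ m → α (φ ⟨$⟩ʳ m) ≡ ψ ⟨$⟩ʳ α m
      conjugates m with Split.exhaustive s m
      ... | inj₁ refl               = proj₂ (α-conjugates-𝒜 s)
      ... | inj₂ (inj₁ refl)        = proj₂ (α-conjugates-𝒜 (flip s))
      ... | inj₂ (inj₂ (inj₁ refl)) = α-conjugates-ℬ Tj (Split.Tl s) (dual-split s)
      ... | inj₂ (inj₂ (inj₂ refl)) =
        α-conjugates-ℬ (Split.Tl s) Tj (Dual.flip (dual-split s))

  embedding⇒conjugate : Embedding φ ψ → Conjugate φ ψ
  embedding⇒conjugate e with any? To𝒜? | any? Toℬ?
    where
    open EmbeddingProperties e

    To𝒜? : ∀ i → Dec (To𝒜 i)
    To𝒜? i with kind i
    ... | inj₁ S = yes S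
    ... | inj₂ T = no λ S → kinds-disjoint S T

    Toℬ? : ∀ i → Dec (Toℬ i)
    Toℬ? i with kind i
    ... | inj₁ S = no (kinds-disjoint S)
    ... | inj₂ T = yes T
  ... | yes (_ , Si) | yes (_ , Tj) = Mixed.mixed⇒conjugate e Si Tj
  ... | _ | no none = EmbeddingProperties.Straight.conjugate e straight
    where
    open EmbeddingProperties e
    straight : ∀ i → To𝒜 i
    straight i with kind i
    ... | inj₁ S = S
    ... | inj₂ T = contradiction (i , T) none
  ... | no none | _ = EmbeddingProperties.Straight.conjugate (dual e) straight
    where
    open EmbeddingProperties e
    straight : ∀ i → EmbeddingProperties.To𝒜 (dual e) i
    straight i with kind i
    ... | inj₁ S = contradiction (i , S) none
    ... | inj₂ T = Mixed.dual-ℬ e T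

theorem3p2 : ∀ (n : ℕ) → n ≥ 4 → (φ ψ : Permutation′ n) →
    (∃[ α ] φ ∘ₚ α ≈ α ∘ₚ ψ) ⇔ (𝔐 n φ ≅ 𝔐 n ψ)
theorem3p2 n n≥4 φ ψ = mk⇔
  (conjugate⇒iso φ ψ)
  (embedding⇒conjugate n≥4 ∘ iso⇒embedding φ ψ)
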